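{- Let $S,T$ be as in the context. If $\mathrm{Pr}_T(x)$ is a $\Sigma_1$ provability predicate of $T$ satisfying $\mathbf{CB}$ and $\mathbf{\Delta_0C}^{\mathrm{U}}$, then $T\nvdash\mathrm{Con}^{\mathrm{H}}_T$.
   Context: $\mathcal{L}_A=\{0,\mathsf{s},+,\times,\leq\}$ is the language of first-order arithmetic, and "formula" means $\mathcal{L}_A$-formula; $\ulcorner\varphi\urcorner$ is the numeral of the Gödel number of $\varphi$. $S$ and $T$ are consistent c.e. extensions of Peano Arithmetic $\mathsf{PA}$ in the language $\mathcal{L}_A$ such that $T$ is stronger than $S$ (every theorem of $S$ is a theorem of $T$; $S=T$ is allowed). A formula $\mathrm{Pr}_T(x)$ is a provability predicate of $T$ if for every formula $\varphi$: $T\vdash\varphi$ if and only if $S\vdash\mathrm{Pr}_T(\ulcorner\varphi\urcorner)$. A $\Sigma_1$ provability predicate is one that is a $\Sigma_1$ formula. $\ulcorner\varphi(\vec{\dot{x}})\urcorner$ is a term with free variables $\vec{x}$ for the primitive recursive function that computes from $\vec{n}$ the Gödel number of $\varphi(\overline{\vec{n}})$, the result of substituting the numerals of $\vec{n}$ for $\vec{x}$ in $\varphi(\vec{x})$. $\mathrm{Con}^{\mathrm{H}}_T :\equiv \forall x\,(\mathrm{Fml}_{\mathcal{L}_A}(x)\land \mathrm{Pr}_T(x)\to\neg\,\mathrm{Pr}_T(\dot\neg\,x))$, where $\mathrm{Fml}_{\mathcal{L}_A}(x)$ naturally expresses "$x$ is the Gödel number of an $\mathcal{L}_A$-formula" and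 $\dot\neg\,x$ is a term for the primitive recursive function sending the Gödel number of $\varphi$ to that of $\neg\varphi$. Conditions on $\mathrm{Pr}_T(x)$: - $\mathbf{CB}$: $S\vdash\mathrm{Pr}_T(\ulcorner\forall\vec{x}\,\varphi(\vec{x})\urcorner)\to\forall\vec{x}\,\mathrm{Pr}_T(\ulcorner\varphi(\vec{\dot{x}})\urcorner)$ for every formula $\varphi(\vec{x})$. - $\mathbf{\Delta_0C}^{\mathrm{U}}$: $S\vdash\forall\vec{x}\,(\varphi(\vec{x})\to\mathrm{Pr}_T(\ulcorner\varphi(\vec{\dot{x}})\urcorner))$ for every $\Delta_0$ formula $\varphi(\vec{x})$. -}

module Defs where

open import Data.Nat using (ℕ; zero; suc; _+_; _*_; _<_)
open import Data.Fin using (Fin; zero; suc; toℕ; splitAt)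
open import Data.List using (List; []; _∷_; map)
open import Data.List.Membership.Propositional using (_∈_)
open import Data.Vec using (Vec; []; _∷_; lookup)
open import Data.Product using (∃-syntax; _×_; _,_; proj₁; proj₂)
open import Data.Sum using (inj₁; inj₂; [_,_]′)
open import Function using (_∘_; _⇔_)
open import Relation.Nullary using (¬_)
open import Relation.Binary.PropositionalEquality
  using (_≡_; refl; sym; trans; cong; cong₂)

------------------------------------------------------------------------
-- Syntax of first-order arithmetic (well-scoped de Bruijn indices)

infixl 7 _⊗_
infixl 6 _⊕_
infix  5 _≐_ _≼_
infix  4 ∼_
infixr 3 _⋀_
infixr 2 _⋁_
infixr 1 _⊃_

data Term (n : ℕ) : Set where
  var     : Fin n → Term n
  𝟎       : Term n
  s       : Term n → Term n
  _⊕_ _⊗_ : Term n → Term n → Term n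

-- Formula n: the free variables are among var 0, …, var (n − 1).
-- A quantifier binds var 0 of its body.
data Formula (n : ℕ) : Set where
  _≐_ _≼_     : Term n → Term n → Formula n
  ∼_          : Formula n → Formula n
  _⋀_ _⋁_ _⊃_ : Formula n → Formula n → Formula n
  ∀′ ∃′       : Formula (suc n) → Formula n

Sentence : Set
Sentence = Formula 0

numeral : ∀ {n} → ℕ → Term n
numeral zero    = 𝟎
numeral (suc k) = s (numeral k)

renTm : ∀ {m n} → (Fin m → Fin n) → Term m → Term n
renTm ρ (var i) = var (ρ i)
renTm ρ 𝟎       = 𝟎
renTm ρ (s t)   = s (renTm ρ t)
renTm ρ (t ⊕ u) = renTm ρ t ⊕ renTm ρ u
renTm ρ (t ⊗ u) = renTm ρ t ⊗ renTm ρ u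

subTm : ∀ {m n} → (Fin m → Term n) → Term m → Term n
subTm σ (var i) = σ i
subTm σ 𝟎       = 𝟎
subTm σ (s t)   = s (subTm σ t)
subTm σ (t ⊕ u) = subTm σ t ⊕ subTm σ u
subTm σ (t ⊗ u) = subTm σ t ⊗ subTm σ u

infix 9 _↑

_↑ : ∀ {n} → Term n → Term (suc n)
_↑ = renTm suc

lift : ∀ {m n} → (Fin m → Term n) → Fin (suc m) → Term (suc n)
lift σ zero    = var zero
lift σ (suc i) = σ i ↑

sub : ∀ {m n} → (Fin m → Term n) → Formula m → Formula n
sub σ (t ≐ u) = subTm σ t ≐ subTm σ u
sub σ (t ≼ u) = subTm σ t ≼ subTm σ u
sub σ (∼ φ)   = ∼ sub σ φ
sub σ (φ ⋀ ψ) = sub σ φ ⋀ sub σ ψ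
sub σ (φ ⋁ ψ) = sub σ φ ⋁ sub σ ψ
sub σ (φ ⊃ ψ) = sub σ φ ⊃ sub σ ψ
sub σ (∀′ φ)  = ∀′ (sub (lift σ) φ)
sub σ (∃′ φ)  = ∃′ (sub (lift σ) φ)

weaken : ∀ {n} → Formula n → Formula (suc n)
weaken = sub (var ∘ suc)

embed : ∀ {n} → Sentence → Formula n
embed = sub (λ ())

infix 9 _[_] _⟪_⟫

_[_] : ∀ {n} → Formula (suc n) → Term n → Formula n
φ [ t ] = sub (λ { zero → t ; (suc i) → var i }) φ

_⟪_⟫ : ∀ {n} → Formula 1 → Term n → Formula n
φ ⟪ t ⟫ = sub (λ _ → t) φ

∀* : ∀ {n} → Formula n → Sentence
∀* {zero}  φ = φ
∀* {suc n} φ = ∀* (∀′ φ)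

data Δ₀ {n : ℕ} : Formula n → Set where
  eq  : ∀ t u → Δ₀ (t ≐ u)
  le  : ∀ t u → Δ₀ (t ≼ u)
  neg : ∀ {φ} → Δ₀ φ → Δ₀ (∼ φ)
  and : ∀ {φ ψ} → Δ₀ φ → Δ₀ ψ → Δ₀ (φ ⋀ ψ)
  or  : ∀ {φ ψ} → Δ₀ φ → Δ₀ ψ → Δ₀ (φ ⋁ ψ)
  imp : ∀ {φ ψ} → Δ₀ φ → Δ₀ ψ → Δ₀ (φ ⊃ ψ)
  -- The bound t ↑ does not contain the quantified variable.
  all : ∀ t {φ} → Δ₀ φ → Δ₀ (∀′ (var zero ≼ t ↑ ⊃ φ))
  ex  : ∀ t {φ} → Δ₀ φ → Δ₀ (∃′ (var zero ≼ t ↑ ⋀ φ))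

data Σ₁ {n : ℕ} : Formula n → Set where
  Δ₀⇒Σ₁ : ∀ {φ} → Δ₀ φ → Σ₁ φ
  ex    : ∀ {φ} → Σ₁ φ → Σ₁ (∃′ φ)

------------------------------------------------------------------------
-- Provability: classical natural deduction with equality

-- A theory is given by its set of non-logical axioms.
Theory : Set₁
Theory = Sentence → Set

infix 0 _∣_⊢_ _⊢_

data _∣_⊢_ (T : Theory) {n : ℕ} (Γ : List (Formula n)) : Formula n → Set where
  axiom : ∀ {φ} → T φ → T ∣ Γ ⊢ embed φ
  hyp   : ∀ {φ} → φ ∈ Γ → T ∣ Γ ⊢ φ
  ∼I    : ∀ {φ ψ} → T ∣ φ ∷ Γ ⊢ ψ → T ∣ φ ∷ Γ ⊢ ∼ ψ → T ∣ Γ ⊢ ∼ φ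
  ∼∼E   : ∀ {φ} → T ∣ Γ ⊢ ∼ ∼ φ → T ∣ Γ ⊢ φ
  ⋀I    : ∀ {φ ψ} → T ∣ Γ ⊢ φ → T ∣ Γ ⊢ ψ → T ∣ Γ ⊢ φ ⋀ ψ
  ⋀E₁   : ∀ {φ ψ} → T ∣ Γ ⊢ φ ⋀ ψ → T ∣ Γ ⊢ φ
  ⋀E₂   : ∀ {φ ψ} → T ∣ Γ ⊢ φ ⋀ ψ → T ∣ Γ ⊢ ψ
  ⋁I₁   : ∀ {φ ψ} → T ∣ Γ ⊢ φ → T ∣ Γ ⊢ φ ⋁ ψ
  ⋁I₂   : ∀ {φ ψ} → T ∣ Γ ⊢ ψ → T ∣ Γ ⊢ φ ⋁ ψ
  ⋁E    : ∀ {φ ψ χ} → T ∣ Γ ⊢ φ ⋁ ψ → T ∣ φ ∷ Γ ⊢ χ → T ∣ ψ ∷ Γ ⊢ χ → T ∣ Γ ⊢ χ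
  ⊃I    : ∀ {φ ψ} → T ∣ φ ∷ Γ ⊢ ψ → T ∣ Γ ⊢ φ ⊃ ψ
  ⊃E    : ∀ {φ ψ} → T ∣ Γ ⊢ φ ⊃ ψ → T ∣ Γ ⊢ φ → T ∣ Γ ⊢ ψ
  ∀I    : ∀ {φ} → T ∣ map weaken Γ ⊢ φ → T ∣ Γ ⊢ ∀′ φ
  ∀E    : ∀ {φ} t → T ∣ Γ ⊢ ∀′ φ → T ∣ Γ ⊢ φ [ t ]
  ∃I    : ∀ {φ} t → T ∣ Γ ⊢ φ [ t ] → T ∣ Γ ⊢ ∃′ φ
  ∃E    : ∀ {φ χ} → T ∣ Γ ⊢ ∃′ φ → T ∣ φ ∷ map weaken Γ ⊢ weaken χ → T ∣ Γ ⊢ χ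
  ≐I    : ∀ t → T ∣ Γ ⊢ t ≐ t
  ≐E    : ∀ φ {t u} → T ∣ Γ ⊢ t ≐ u → T ∣ Γ ⊢ φ [ t ] → T ∣ Γ ⊢ φ [ u ]

_⊢_ : ∀ {n} → Theory → Formula n → Set
T ⊢ φ = T ∣ [] ⊢ φ

Consistent : Theory → Set
Consistent T = ∀ (φ : Sentence) → ¬ ((T ⊢ φ) × (T ⊢ ∼ φ))

infix 4 _⊑_

_⊑_ : Theory → Theory → Set
S ⊑ T = ∀ {n} (φ : Formula n) → S ⊢ φ → T ⊢ φ

pattern v0 = var zero
pattern v1 = var (suc zero)
pattern v2 = var (suc (suc zero))
pattern v3 = var (suc (suc (suc zero)))
pattern v4 = var (suc (suc (suc (suc zero))))
pattern v5 = var (suc (suc (suc (suc (suc zero)))))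
pattern v6 = var (suc (suc (suc (suc (suc (suc zero))))))

data PA : Theory where
  s≢0   : PA (∀′ (∼ s v0 ≐ 𝟎))
  s-inj : PA (∀′ (∀′ (s v1 ≐ s v0 ⊃ v1 ≐ v0)))
  ⊕-0   : PA (∀′ (v0 ⊕ 𝟎 ≐ v0))
  ⊕-s   : PA (∀′ (∀′ (v1 ⊕ s v0 ≐ s (v1 ⊕ v0))))
  ⊗-0   : PA (∀′ (v0 ⊗ 𝟎 ≐ 𝟎))
  ⊗-s   : PA (∀′ (∀′ (v1 ⊗ s v0 ≐ v1 ⊗ v0 ⊕ v1)))
  ≼-def : PA (∀′ (∀′ ((v1 ≼ v0 ⊃ ∃′ (v0 ⊕ v2 ≐ v1)) ⋀ (∃′ (v0 ⊕ v2 ≐ v1) ⊃ v1 ≼ v0))))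
  induction : ∀ {n} (φ : Formula (suc n)) →
    PA (∀* (φ [ 𝟎 ] ⋀ ∀′ (φ ⊃ sub (λ { zero → s v0 ; (suc i) → var (suc i) }) φ) ⊃ ∀′ φ))

------------------------------------------------------------------------
-- Gödel numbering

-- The injection (a + b)² + a is used for pairing because, unlike Cantor's
-- bijection, it is the value of a term of the language.
pair : ℕ → ℕ → ℕ
pair a b = (a + b) * (a + b) + a

-- A term is uniquely sᵏ t with t not a successor.  It is coded by the pair of
-- k and a code of t, so that the code of a numeral is a polynomial in its value.
gnTm : ∀ {n} → Term n → ℕ × ℕ
gnTm (var i) = 0 , pair 1 (toℕ i)
gnTm 𝟎       = 0 , pair 0 0
gnTm (s t)   = let (k , c) = gnTm t in suc k , c
gnTm (t ⊕ u) =
  let (k , c) = gnTm t ; (l , d) = gnTm u in 0 , pair 2 (pair (pair k c) (pair l d))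
gnTm (t ⊗ u) =
  let (k , c) = gnTm t ; (l , d) = gnTm u in 0 , pair 3 (pair (pair k c) (pair l d))

gnTerm : ∀ {n} → Term n → ℕ
gnTerm t = pair (proj₁ (gnTm t)) (proj₂ (gnTm t))

gn : ∀ {n} → Formula n → ℕ
gn (t ≐ u) = pair 0 (pair (gnTerm t) (gnTerm u))
gn (t ≼ u) = pair 1 (pair (gnTerm t) (gnTerm u))
gn (∼ φ)   = pair 2 (gn φ)
gn (φ ⋀ ψ) = pair 3 (pair (gn φ) (gn ψ))
gn (φ ⋁ ψ) = pair 4 (pair (gn φ) (gn ψ))
gn (φ ⊃ ψ) = pair 5 (pair (gn φ) (gn ψ))
gn (∀′ φ)  = pair 6 (gn φ)
gn (∃′ φ)  = pair 7 (gn φ)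

⌜_⌝ : ∀ {m n} → Formula m → Term n
⌜ φ ⌝ = numeral (gn φ)

⟨_,_⟩ : ∀ {n} → Term n → Term n → Term n
⟨ t , u ⟩ = (t ⊕ u) ⊗ (t ⊕ u) ⊕ t

infix 9 ∼̇_

∼̇_ : ∀ {n} → Term n → Term n
∼̇ t = ⟨ numeral 2 , t ⟩

-- The following functions mirror gnTm and gn, with values given by terms.  In a
-- formula with m + k variables in scope, the first m are the ones bound so far
-- and are coded as variables; the others are the dotted ones, and var x among
-- them stands for the numeral of the value of x, whose code is ⟨ x , ⟨ 0 , 0 ⟩ ⟩.
dotTm : ∀ m {k} → Term (m + k) → Term k × Term k
dotTm m (var i) = [ (λ j → 𝟎     , ⟨ numeral 1 , numeral (toℕ j) ⟩)
                  , (λ x → var x , ⟨ 𝟎 , 𝟎 ⟩) ]′ (splitAt m i)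
dotTm m 𝟎       = 𝟎 , ⟨ 𝟎 , 𝟎 ⟩
dotTm m (s t)   = let (k , c) = dotTm m t in s k , c
dotTm m (t ⊕ u) =
  let (k , c) = dotTm m t ; (l , d) = dotTm m u
  in 𝟎 , ⟨ numeral 2 , ⟨ ⟨ k , c ⟩ , ⟨ l , d ⟩ ⟩ ⟩
dotTm m (t ⊗ u) =
  let (k , c) = dotTm m t ; (l , d) = dotTm m u
  in 𝟎 , ⟨ numeral 3 , ⟨ ⟨ k , c ⟩ , ⟨ l , d ⟩ ⟩ ⟩

dotTerm : ∀ m {k} → Term (m + k) → Term k
dotTerm m t = ⟨ proj₁ (dotTm m t) , proj₂ (dotTm m t) ⟩

dot : ∀ m {k} → Formula (m + k) → Term k
dot m (t ≐ u) = ⟨ numeral 0 , ⟨ dotTerm m t , dotTerm m u ⟩ ⟩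
dot m (t ≼ u) = ⟨ numeral 1 , ⟨ dotTerm m t , dotTerm m u ⟩ ⟩
dot m (∼ φ)   = ⟨ numeral 2 , dot m φ ⟩
dot m (φ ⋀ ψ) = ⟨ numeral 3 , ⟨ dot m φ , dot m ψ ⟩ ⟩
dot m (φ ⋁ ψ) = ⟨ numeral 4 , ⟨ dot m φ , dot m ψ ⟩ ⟩
dot m (φ ⊃ ψ) = ⟨ numeral 5 , ⟨ dot m φ , dot m ψ ⟩ ⟩
dot m (∀′ φ)  = ⟨ numeral 6 , dot (suc m) φ ⟩
dot m (∃′ φ)  = ⟨ numeral 7 , dot (suc m) φ ⟩

-- The term with free variables x⃗ for the Gödel number of φ with the numerals of
-- x⃗ substituted for its variables; see value-dotted.
⌜_˙⌝ : ∀ {k} → Formula k → Term k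
⌜ φ ˙⌝ = dot 0 φ

-- The term has the intended values in the standard model.
value : ∀ {n} → (Fin n → ℕ) → Term n → ℕ
value ρ (var i) = ρ i
value ρ 𝟎       = 0
value ρ (s t)   = suc (value ρ t)
value ρ (t ⊕ u) = value ρ t + value ρ u
value ρ (t ⊗ u) = value ρ t * value ρ u

private
  value-numeral : ∀ {n} (ρ : Fin n → ℕ) k → value ρ (numeral k) ≡ k
  value-numeral ρ zero    = refl
  value-numeral ρ (suc k) = cong suc (value-numeral ρ k)

  ↑-numeral : ∀ {n} k → numeral {n} k ↑ ≡ numeral k
  ↑-numeral zero    = refl
  ↑-numeral (suc k) = cong s (↑-numeral k)

  gnTm-numeral : ∀ {n} k → gnTm (numeral {n} k) ≡ (k , 0)
  gnTm-numeral zero    = refl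
  gnTm-numeral (suc k) = cong (λ p → suc (proj₁ p) , proj₂ p) (gnTm-numeral k)

  module _ {k} (ρ : Fin k → ℕ) where

    at : ∀ m → Fin (m + k) → Term m
    at m i = [ var , numeral ∘ ρ ]′ (splitAt m i)

    lift-at : ∀ {m} {σ : Fin (m + k) → Term m} →
              (∀ i → σ i ≡ at m i) → ∀ i → lift σ i ≡ at (suc m) i
    lift-at {m} h zero = refl
    lift-at {m} h (suc i) with splitAt m i | h i
    ... | inj₁ j | e = cong _↑ e
    ... | inj₂ x | e = trans (cong _↑ e) (↑-numeral (ρ x))

    value² : Term k × Term k → ℕ × ℕ
    value² (t , u) = value ρ t , value ρ u

    pair² : ℕ × ℕ → ℕ
    pair² (a , b) = pair a b

    value-dotTm : ∀ m (σ : Fin (m + k) → Term m) → (∀ i → σ i ≡ at m i) →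
                  ∀ t → value² (dotTm m t) ≡ gnTm (subTm σ t)
    value-dotTm m σ h (var i) with splitAt m i | h i
    ... | inj₁ j | e rewrite e | value-numeral ρ (toℕ j) = refl
    ... | inj₂ x | e rewrite e = sym (gnTm-numeral (ρ x))
    value-dotTm m σ h 𝟎       = refl
    value-dotTm m σ h (s t)   =
      cong (λ p → suc (proj₁ p) , proj₂ p) (value-dotTm m σ h t)
    value-dotTm m σ h (t ⊕ u) =
      cong₂ (λ p q → 0 , pair 2 (pair (pair² p) (pair² q)))
            (value-dotTm m σ h t) (value-dotTm m σ h u)
    value-dotTm m σ h (t ⊗ u) =
      cong₂ (λ p q → 0 , pair 3 (pair (pair² p) (pair² q)))
            (value-dotTm m σ h t) (value-dotTm m σ h u)

    value-dot : ∀ m (σ : Fin (m + k) → Term m) → (∀ i → σ i ≡ at m i) →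
                ∀ φ → value ρ (dot m φ) ≡ gn (sub σ φ)
    value-dot m σ h (t ≐ u) =
      cong₂ (λ p q → pair 0 (pair (pair² p) (pair² q)))
            (value-dotTm m σ h t) (value-dotTm m σ h u)
    value-dot m σ h (t ≼ u) =
      cong₂ (λ p q → pair 1 (pair (pair² p) (pair² q)))
            (value-dotTm m σ h t) (value-dotTm m σ h u)
    value-dot m σ h (∼ φ)   = cong (pair 2) (value-dot m σ h φ)
    value-dot m σ h (φ ⋀ ψ) =
      cong₂ (λ a b → pair 3 (pair a b)) (value-dot m σ h φ) (value-dot m σ h ψ)
    value-dot m σ h (φ ⋁ ψ) =
      cong₂ (λ a b → pair 4 (pair a b)) (value-dot m σ h φ) (value-dot m σ h ψ)
    value-dot m σ h (φ ⊃ ψ) =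
      cong₂ (λ a b → pair 5 (pair a b)) (value-dot m σ h φ) (value-dot m σ h ψ)
    value-dot m σ h (∀′ φ)  =
      cong (pair 6) (value-dot (suc m) (lift σ) (lift-at h) φ)
    value-dot m σ h (∃′ φ)  =
      cong (pair 7) (value-dot (suc m) (lift σ) (lift-at h) φ)

value-dotted : ∀ {k} (ρ : Fin k → ℕ) (φ : Formula k) →
               value ρ ⌜ φ ˙⌝ ≡ gn (sub {n = 0} (numeral ∘ ρ) φ)
value-dotted ρ = value-dot ρ 0 (numeral ∘ ρ) (λ _ → refl)

------------------------------------------------------------------------
-- The formula expressing "x is the Gödel number of a formula"

-- The number c coded with parameter d represents the set of all y such that
-- 1 + (y + 1)d divides c.  By the Chinese remainder theorem, every set of numbers
-- is represented in this way up to any given bound.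
infix 5 _∈[_,_]

_∈[_,_] : ∀ {n} → Term n → Term n → Term n → Formula n
y ∈[ c , d ] = ∃′ (s (s (y ↑) ⊗ d ↑) ⊗ v0 ≐ c ↑)

-- least step expresses that x belongs to every represented set that is closed,
-- up to x, under the generation rules given by step (variables: y, d, c, x),
-- where step says that y is generated from members of the set (c, d).  All rules
-- below generate numbers from smaller ones, so the cut-off at x is harmless.
least : Formula 4 → Formula 1
least step =
  ∀′ (∀′ (∀′ (v0 ≼ v3 ⋀ step ⊃ v0 ∈[ v2 , v1 ]) ⊃ v2 ∈[ v1 , v0 ]))

TmCode : Formula 1
TmCode = least (∃′ (∃′ (v2 ≐ ⟨ v1 , v0 ⟩ ⋀
  ( v0 ≐ ⟨ 𝟎 , 𝟎 ⟩
  ⋁ ∃′ (v1 ≐ ⟨ numeral 1 , v0 ⟩)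
  ⋁ ∃′ (∃′ (v1 ∈[ v6 , v5 ] ⋀ v0 ∈[ v6 , v5 ] ⋀
       ( v2 ≐ ⟨ numeral 2 , ⟨ v1 , v0 ⟩ ⟩
       ⋁ v2 ≐ ⟨ numeral 3 , ⟨ v1 , v0 ⟩ ⟩)))))))

Fml : Formula 1
Fml = least
  ( ∃′ (∃′ (TmCode ⟪ v1 ⟫ ⋀ TmCode ⟪ v0 ⟫ ⋀
      ( v2 ≐ ⟨ numeral 0 , ⟨ v1 , v0 ⟩ ⟩
      ⋁ v2 ≐ ⟨ numeral 1 , ⟨ v1 , v0 ⟩ ⟩)))
  ⋁ ∃′ (v0 ∈[ v3 , v2 ] ⋀
      ( v1 ≐ ⟨ numeral 2 , v0 ⟩
      ⋁ v1 ≐ ⟨ numeral 6 , v0 ⟩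
      ⋁ v1 ≐ ⟨ numeral 7 , v0 ⟩))
  ⋁ ∃′ (∃′ (v1 ∈[ v4 , v3 ] ⋀ v0 ∈[ v4 , v3 ] ⋀
      ( v2 ≐ ⟨ numeral 3 , ⟨ v1 , v0 ⟩ ⟩
      ⋁ v2 ≐ ⟨ numeral 4 , ⟨ v1 , v0 ⟩ ⟩
      ⋁ v2 ≐ ⟨ numeral 5 , ⟨ v1 , v0 ⟩ ⟩))))

------------------------------------------------------------------------
-- Computably enumerable theories

data Rec : ℕ → Set where
  zero : Rec 0
  suc  : Rec 1
  proj : ∀ {n} → Fin n → Rec n
  comp : ∀ {m n} → Rec m → Vec (Rec n) m → Rec n
  prim : ∀ {n} → Rec n → Rec (suc (suc n)) → Rec (suc n)
  mu   : ∀ {n} → Rec (suc n) → Rec n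

infix 4 _·_⇓_ _·_⇓*_

mutual
  -- f · xs ⇓ y: the partial recursive function f is defined at xs with value y.
  data _·_⇓_ : ∀ {n} → Rec n → Vec ℕ n → ℕ → Set where
    zero  : zero · [] ⇓ 0
    suc   : ∀ {x} → suc · (x ∷ []) ⇓ suc x
    proj  : ∀ {n} (i : Fin n) xs → proj i · xs ⇓ lookup xs i
    comp  : ∀ {m n} {f : Rec m} {gs : Vec (Rec n) m} {xs ys z} →
            gs · xs ⇓* ys → f · ys ⇓ z → comp f gs · xs ⇓ z
    prim0 : ∀ {n} {f : Rec n} {g xs z} → f · xs ⇓ z → prim f g · (0 ∷ xs) ⇓ z
    prims : ∀ {n} {f : Rec n} {g xs x y z} → prim f g · (x ∷ xs) ⇓ y →
            g · (x ∷ y ∷ xs) ⇓ z → prim f g · (suc x ∷ xs) ⇓ z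
    mu    : ∀ {n} {f : Rec (suc n)} {xs y} → f · (y ∷ xs) ⇓ 0 →
            (∀ z → z < y → ∃[ w ] (f · (z ∷ xs) ⇓ suc w)) → mu f · xs ⇓ y

  data _·_⇓*_ : ∀ {m n} → Vec (Rec n) m → Vec ℕ n → Vec ℕ m → Set where
    []  : ∀ {n} {xs : Vec ℕ n} → [] · xs ⇓* []
    _∷_ : ∀ {m n} {g : Rec n} {gs : Vec (Rec n) m} {xs y ys} →
          g · xs ⇓ y → gs · xs ⇓* ys → g ∷ gs · xs ⇓* y ∷ ys

-- The domain of a partial recursive function.
CE : (ℕ → Set) → Set
CE A = ∃[ f ] (∀ n → A n ⇔ (∃[ v ] (f · (n ∷ []) ⇓ v)))

CETheory : Theory → Set
CETheory T = CE (λ n → ∃[ φ ] (T φ × gn φ ≡ n))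

------------------------------------------------------------------------
-- Provability predicates

-- In the following, Pr is the formula Pr_T(x), with x the variable v0.

IsProvabilityPredicate : (S T : Theory) → Formula 1 → Set
IsProvabilityPredicate S T Pr =
  ∀ {n} (φ : Formula n) → (T ⊢ φ) ⇔ (_⊢_ {0} S (Pr ⟪ ⌜ φ ⌝ ⟫))

CB : (S : Theory) → Formula 1 → Set
CB S Pr = ∀ {k} (φ : Formula k) →
  S ⊢ Pr ⟪ ⌜ ∀* φ ⌝ ⟫ ⊃ ∀* (Pr ⟪ ⌜ φ ˙⌝ ⟫)

Δ₀Cᵁ : (S : Theory) → Formula 1 → Set
Δ₀Cᵁ S Pr = ∀ {k} (φ : Formula k) → Δ₀ φ →
  S ⊢ ∀* (φ ⊃ Pr ⟪ ⌜ φ ˙⌝ ⟫)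

Conᴴ : Formula 1 → Sentence
Conᴴ Pr = ∀′ (Fml ⋀ Pr ⊃ ∼ Pr ⟪ ∼̇ v0 ⟫)

{-# OPTIONS --safe #-}
module Submission where

-- Let π = ∀x⃗ χ(x⃗) with χ a Δ₀ formula.  If χ(x⃗) fails, then Pr(⌜∼ χ(ẋ⃗)⌝) by
-- Δ₀Cᵁ, hence ∼ Pr(⌜χ(ẋ⃗)⌝) by Conᴴ, hence ∼ Pr(⌜π⌝) by CB.  So in T, Conᴴ implies the
-- reflection principle Pr(⌜π⌝) ⊃ π.  Apply it to a prenex Π₁ Gödel sentence γ, equivalent
-- to ∼ Pr(⌜γ⌝): T refutes Pr(⌜γ⌝), so it proves γ, so it proves Pr(⌜γ⌝) as well.
-- No coding of sequences is needed in PA: Fml speaks of all closed sets, so the rules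
-- generating the code of χ are just replayed inside an arbitrary closed set.

open import Defs
open import Data.Fin using (Fin; zero; suc; toℕ; splitAt)
open import Data.List using (List; []; _∷_; map)
open import Data.List.Relation.Unary.Any using (here; there)
open import Data.Nat using (ℕ; zero; suc; _+_; _*_)
open import Data.Nat.Properties using (+-identityʳ; +-suc; +-comm; *-zeroʳ; *-suc)
open import Data.Product using (_×_; _,_; proj₁; proj₂; Σ-syntax)
open import Data.Sum using (_⊎_; inj₁; inj₂)
open import Data.Vec.Functional using (updateAt) renaming (_∷_ to _▸_; [] to ε)
open import Data.Vec.Functional.Properties 
  using (map-updateAt; updateAt-updates; updateAt-updateAt; updateAt-id-local)
open import Function using (_∘_; id; const)
open import Function.Bundles using (module Equivalence)
open import Relation.Nullary using (¬_)
open import Relation.Binary.PropositionalEquality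
  using (_≡_; _≗_; refl; sym; trans; cong; cong₂; subst; subst₂; module ≡-Reasoning)

private variable
  l m n k : ℕ
  T : Theory

-- Substitution

Env : ℕ → ℕ → Set
Env m n = Fin m → Term n

subTm-cong : {σ τ : Env m n} → σ ≗ τ → subTm σ ≗ subTm τ
subTm-cong h (var i) = h i
subTm-cong h 𝟎       = refl
subTm-cong h (s t)   = cong s (subTm-cong h t)
subTm-cong h (t ⊕ u) = cong₂ _⊕_ (subTm-cong h t) (subTm-cong h u)
subTm-cong h (t ⊗ u) = cong₂ _⊗_ (subTm-cong h t) (subTm-cong h u)

subTm-var : ∀ (t : Term n) → subTm var t ≡ t
subTm-var (var i) = refl
subTm-var 𝟎       = refl
subTm-var (s t)   = cong s (subTm-var t)
subTm-var (t ⊕ u) = cong₂ _⊕_ (subTm-var t) (subTm-var u)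
subTm-var (t ⊗ u) = cong₂ _⊗_ (subTm-var t) (subTm-var u)

subTm-↑ : ∀ (σ : Env (suc m) n) t → subTm σ (t ↑) ≡ subTm (σ ∘ suc) t
subTm-↑ σ (var i) = refl
subTm-↑ σ 𝟎       = refl
subTm-↑ σ (s t)   = cong s (subTm-↑ σ t)
subTm-↑ σ (t ⊕ u) = cong₂ _⊕_ (subTm-↑ σ t) (subTm-↑ σ u)
subTm-↑ σ (t ⊗ u) = cong₂ _⊗_ (subTm-↑ σ t) (subTm-↑ σ u)

↑-subTm : ∀ (σ : Env m n) t → subTm σ t ↑ ≡ subTm (_↑ ∘ σ) t
↑-subTm σ (var i) = refl
↑-subTm σ 𝟎       = refl
↑-subTm σ (s t)   = cong s (↑-subTm σ t)
↑-subTm σ (t ⊕ u) = cong₂ _⊕_ (↑-subTm σ t) (↑-subTm σ u)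
↑-subTm σ (t ⊗ u) = cong₂ _⊗_ (↑-subTm σ t) (↑-subTm σ u)

subTm-lift-↑ : ∀ (σ : Env m n) t → subTm (lift σ) (t ↑) ≡ subTm σ t ↑
subTm-lift-↑ σ t = trans (subTm-↑ (lift σ) t) (sym (↑-subTm σ t))

subTm-▸-↑ : ∀ (t u : Term n) → subTm (t ▸ var) (u ↑) ≡ u
subTm-▸-↑ t u = trans (subTm-↑ _ u) (subTm-var u)

subTm-numeral : ∀ (σ : Env m n) j → subTm σ (numeral j) ≡ numeral j
subTm-numeral σ zero    = refl
subTm-numeral σ (suc j) = cong s (subTm-numeral σ j)

↑-numeral : ∀ j → numeral {n} j ↑ ≡ numeral j
↑-numeral zero    = refl
↑-numeral (suc j) = cong s (↑-numeral j)

lift-cong : {σ τ : Env m n} → σ ≗ τ → lift σ ≗ lift τ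
lift-cong h zero    = refl
lift-cong h (suc i) = cong _↑ (h i)

sub-cong : {σ τ : Env m n} → σ ≗ τ → sub σ ≗ sub τ
sub-cong h (t ≐ u) = cong₂ _≐_ (subTm-cong h t) (subTm-cong h u)
sub-cong h (t ≼ u) = cong₂ _≼_ (subTm-cong h t) (subTm-cong h u)
sub-cong h (∼ φ)   = cong ∼_ (sub-cong h φ)
sub-cong h (φ ⋀ ψ) = cong₂ _⋀_ (sub-cong h φ) (sub-cong h ψ)
sub-cong h (φ ⋁ ψ) = cong₂ _⋁_ (sub-cong h φ) (sub-cong h ψ)
sub-cong h (φ ⊃ ψ) = cong₂ _⊃_ (sub-cong h φ) (sub-cong h ψ)
sub-cong h (∀′ φ)  = cong ∀′ (sub-cong (lift-cong h) φ)
sub-cong h (∃′ φ)  = cong ∃′ (sub-cong (lift-cong h) φ)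

lift-var : lift {n} var ≗ var
lift-var zero    = refl
lift-var (suc i) = refl

sub-var : ∀ (φ : Formula n) → sub var φ ≡ φ
sub-var (t ≐ u) = cong₂ _≐_ (subTm-var t) (subTm-var u)
sub-var (t ≼ u) = cong₂ _≼_ (subTm-var t) (subTm-var u)
sub-var (∼ φ)   = cong ∼_ (sub-var φ)
sub-var (φ ⋀ ψ) = cong₂ _⋀_ (sub-var φ) (sub-var ψ)
sub-var (φ ⋁ ψ) = cong₂ _⋁_ (sub-var φ) (sub-var ψ)
sub-var (φ ⊃ ψ) = cong₂ _⊃_ (sub-var φ) (sub-var ψ)
sub-var (∀′ φ)  = cong ∀′ (trans (sub-cong lift-var φ) (sub-var φ))
sub-var (∃′ φ)  = cong ∃′ (trans (sub-cong lift-var φ) (sub-var φ))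

subTm-subTm : ∀ (τ : Env m n) (σ : Env l m) t → subTm τ (subTm σ t) ≡ subTm (subTm τ ∘ σ) t
subTm-subTm τ σ (var i) = refl
subTm-subTm τ σ 𝟎       = refl
subTm-subTm τ σ (s t)   = cong s (subTm-subTm τ σ t)
subTm-subTm τ σ (t ⊕ u) = cong₂ _⊕_ (subTm-subTm τ σ t) (subTm-subTm τ σ u)
subTm-subTm τ σ (t ⊗ u) = cong₂ _⊗_ (subTm-subTm τ σ t) (subTm-subTm τ σ u)

lift-∘ : ∀ (τ : Env m n) (σ : Env l m) → subTm (lift τ) ∘ lift σ ≗ lift (subTm τ ∘ σ)
lift-∘ τ σ zero    = refl
lift-∘ τ σ (suc i) = subTm-lift-↑ τ (σ i)

sub-sub : ∀ (τ : Env m n) (σ : Env l m) φ → sub τ (sub σ φ) ≡ sub (subTm τ ∘ σ) φ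
sub-sub τ σ (t ≐ u) = cong₂ _≐_ (subTm-subTm τ σ t) (subTm-subTm τ σ u)
sub-sub τ σ (t ≼ u) = cong₂ _≼_ (subTm-subTm τ σ t) (subTm-subTm τ σ u)
sub-sub τ σ (∼ φ)   = cong ∼_ (sub-sub τ σ φ)
sub-sub τ σ (φ ⋀ ψ) = cong₂ _⋀_ (sub-sub τ σ φ) (sub-sub τ σ ψ)
sub-sub τ σ (φ ⋁ ψ) = cong₂ _⋁_ (sub-sub τ σ φ) (sub-sub τ σ ψ)
sub-sub τ σ (φ ⊃ ψ) = cong₂ _⊃_ (sub-sub τ σ φ) (sub-sub τ σ ψ)
sub-sub τ σ (∀′ φ)  =
  cong ∀′ (trans (sub-sub (lift τ) (lift σ) φ) (sub-cong (lift-∘ τ σ) φ))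
sub-sub τ σ (∃′ φ)  =
  cong ∃′ (trans (sub-sub (lift τ) (lift σ) φ) (sub-cong (lift-∘ τ σ) φ))

sub-sub-≗ : ∀ {τ : Env m n} {σ : Env l m} {υ} → subTm τ ∘ σ ≗ υ →
            ∀ φ → sub τ (sub σ φ) ≡ sub υ φ
sub-sub-≗ h φ = trans (sub-sub _ _ φ) (sub-cong h φ)

weaken-sub : ∀ (σ : Env m n) φ → weaken (sub σ φ) ≡ sub (_↑ ∘ σ) φ
weaken-sub σ = sub-sub-≗ λ i → subTm-suc (σ i)
  where
  subTm-suc : ∀ t → subTm (var ∘ suc) t ≡ t ↑
  subTm-suc t = trans (sym (↑-subTm var t)) (cong _↑ (subTm-var t))

weaken-embed : ∀ (φ : Sentence) → weaken (embed {n} φ) ≡ embed φ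
weaken-embed = sub-sub-≗ λ ()

map-weaken-embed : ∀ (Γ : List Sentence) → map (weaken {n}) (map embed Γ) ≡ map embed Γ
map-weaken-embed []      = refl
map-weaken-embed (φ ∷ Γ) = cong₂ _∷_ (weaken-embed φ) (map-weaken-embed Γ)

embed-id : ∀ (φ : Sentence) → embed φ ≡ φ
embed-id φ = trans (sub-cong (λ ()) φ) (sub-var φ)

map-embed-id : ∀ (Γ : List Sentence) → map embed Γ ≡ Γ
map-embed-id []      = refl
map-embed-id (φ ∷ Γ) = cong₂ _∷_ (embed-id φ) (map-embed-id Γ)

-- [ t ] substitutes by an extended lambda, which can only be compared pointwise.
[]-▸ : ∀ (φ : Formula (suc n)) t → φ [ t ] ≡ sub (t ▸ var) φ
[]-▸ φ t = sub-cong (λ { zero → refl ; (suc i) → refl }) φ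

lift-[] : ∀ (σ : Env m n) φ t → sub (lift σ) φ [ t ] ≡ sub (t ▸ σ) φ
lift-[] σ φ t = trans ([]-▸ (sub (lift σ) φ) t)
  (sub-sub-≗ (λ { zero → refl ; (suc i) → subTm-▸-↑ t (σ i) }) φ)

-- Derived rules of natural deduction

private variable
  Γ : List (Formula n)

cast : {φ ψ : Formula n} → φ ≡ ψ → T ∣ Γ ⊢ φ → T ∣ Γ ⊢ ψ
cast refl d = d

hyp₀ : ∀ {φ : Formula n} → T ∣ φ ∷ Γ ⊢ φ
hyp₀ = hyp (here refl)

hyp₁ : ∀ {φ ψ : Formula n} → T ∣ ψ ∷ φ ∷ Γ ⊢ φ
hyp₁ = hyp (there (here refl))

cut : ∀ {φ ψ : Formula n} → T ∣ Γ ⊢ φ → T ∣ φ ∷ Γ ⊢ ψ → T ∣ Γ ⊢ ψ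
cut d e = ⊃E (⊃I e) d

-- Weakening is not a rule of the calculus, so `d` and `e` cannot be moved under the extra
-- assumption `∼ ψ`. The implication is derived from hypotheses alone and then applied to them.
∼E : ∀ {φ ψ : Formula n} → T ∣ Γ ⊢ φ → T ∣ Γ ⊢ ∼ φ → T ∣ Γ ⊢ ψ
∼E d e = ∼∼E (⊃E (⊃E (⊃I (⊃I (∼I (hyp (there (there (here refl)))) hyp₁))) d) e)

-- The `▸` rules keep a formula apart from its environment: instantiating a quantifier merely
-- extends the environment, and a concrete formula then computes to its instance.
∀E▸ : ∀ (φ : Formula (suc m)) (σ : Env m n) t → T ∣ Γ ⊢ sub σ (∀′ φ) → T ∣ Γ ⊢ sub (t ▸ σ) φ
∀E▸ φ σ t d = cast (lift-[] σ φ t) (∀E t d)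

∃I▸ : ∀ (φ : Formula (suc m)) (σ : Env m n) t → T ∣ Γ ⊢ sub (t ▸ σ) φ → T ∣ Γ ⊢ sub σ (∃′ φ)
∃I▸ φ σ t d = ∃I t (cast (sym (lift-[] σ φ t)) d)

≐E▸ : ∀ (φ : Formula (suc m)) (σ : Env m n) {t u} → T ∣ Γ ⊢ t ≐ u →
      T ∣ Γ ⊢ sub (t ▸ σ) φ → T ∣ Γ ⊢ sub (u ▸ σ) φ
≐E▸ φ σ {t} {u} e d = cast (lift-[] σ φ u)
  (≐E (sub (lift σ) φ) e (cast (sym (lift-[] σ φ t)) d))

∀*E : ∀ (φ : Formula m) (σ : Env m n) → T ∣ Γ ⊢ embed (∀* φ) → T ∣ Γ ⊢ sub σ φ
∀*E {zero}  φ σ d = cast (sub-cong (λ ()) φ) d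
∀*E {suc m} φ σ d = cast (sub-cong (λ { zero → refl ; (suc i) → refl }) φ)
  (∀E▸ φ (σ ∘ suc) (σ zero) (∀*E (∀′ φ) (σ ∘ suc) d))

∀*I : ∀ {Γ : List Sentence} (φ : Formula m) → T ∣ map embed Γ ⊢ φ → T ∣ Γ ⊢ ∀* φ
∀*I {zero}  {Γ = Γ} φ d = subst (_ ∣_⊢ φ) (map-embed-id Γ) d
∀*I {suc m} {Γ = Γ} φ d =
  ∀*I (∀′ φ) (∀I (subst (_ ∣_⊢ φ) (sym (map-weaken-embed Γ)) d))

∼∃I : ∀ (φ : Formula (suc n)) → T ∣ Γ ⊢ ∀′ (∼ φ) → T ∣ Γ ⊢ ∼ ∃′ φ
-- `contra` proves every formula; the absurdity is stated with `𝟎 ≐ 𝟎`, which `weaken` leaves fixed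
-- as `∃E` demands.
∼∃I φ d = cut d (∼I {ψ = 𝟎 ≐ 𝟎} (∃E hyp₀ contra) (∃E hyp₀ contra))
  where
  open-var : v0 ▸ (var ∘ suc) ≗ var
  open-var zero    = refl
  open-var (suc i) = refl
  contra : ∀ {ψ} → T ∣ φ ∷ map weaken (∃′ φ ∷ ∀′ (∼ φ) ∷ Γ) ⊢ ψ
  contra = ∼E hyp₀ (cast (trans (sub-cong open-var (∼ φ)) (sub-var (∼ φ)))
    (∀E▸ (∼ φ) (var ∘ suc) v0 (hyp (there (there (here refl))))))

∃E▸ : ∀ (φ : Formula (suc m)) (χ : Formula m) (σ : Env m n) → T ∣ Γ ⊢ sub σ (∃′ φ) →
      T ∣ sub (v0 ▸ (_↑ ∘ σ)) φ ∷ map weaken Γ ⊢ sub (_↑ ∘ σ) χ → T ∣ Γ ⊢ sub σ χ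
∃E▸ φ χ σ d e = ∃E d (subst₂ (λ ψ χ → _ ∣ ψ ∷ _ ⊢ χ)
  (sub-cong (λ { zero → refl ; (suc i) → refl }) φ) (sym (weaken-sub σ χ)) e)

≐-sym : ∀ {t u : Term n} → T ∣ Γ ⊢ t ≐ u → T ∣ Γ ⊢ u ≐ t
≐-sym {t = t} e = ≐E▸ (v0 ≐ v1) (t ▸ ε) e (≐I t)

≐-trans : ∀ {t u v : Term n} → T ∣ Γ ⊢ t ≐ u → T ∣ Γ ⊢ u ≐ v → T ∣ Γ ⊢ t ≐ v
≐-trans {t = t} d e = ≐E▸ (v1 ≐ v0) (t ▸ ε) e d

s-cong : ∀ {t u : Term n} → T ∣ Γ ⊢ t ≐ u → T ∣ Γ ⊢ s t ≐ s u
s-cong {t = t} e = ≐E▸ (s v1 ≐ s v0) (t ▸ ε) e (≐I (s t))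

⊕-cong : ∀ {t u t′ u′ : Term n} → T ∣ Γ ⊢ t ≐ t′ → T ∣ Γ ⊢ u ≐ u′ → T ∣ Γ ⊢ t ⊕ u ≐ t′ ⊕ u′
⊕-cong {t = t} {u} {t′} d e = ≐E▸ (v1 ⊕ v2 ≐ v3 ⊕ v0) (t ▸ u ▸ t′ ▸ ε) e
  (≐E▸ (v1 ⊕ v2 ≐ v0 ⊕ v2) (t ▸ u ▸ ε) d (≐I (t ⊕ u)))

⊗-cong : ∀ {t u t′ u′ : Term n} → T ∣ Γ ⊢ t ≐ t′ → T ∣ Γ ⊢ u ≐ u′ → T ∣ Γ ⊢ t ⊗ u ≐ t′ ⊗ u′
⊗-cong {t = t} {u} {t′} d e = ≐E▸ (v1 ⊗ v2 ≐ v3 ⊗ v0) (t ▸ u ▸ t′ ▸ ε) e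
  (≐E▸ (v1 ⊗ v2 ≐ v0 ⊗ v2) (t ▸ u ▸ ε) d (≐I (t ⊗ u)))

updateAt-cong-≗ : ∀ {σ τ : Env m n} i {f} → σ ≗ τ → updateAt σ i f ≗ updateAt τ i f
updateAt-cong-≗ zero    {f} h zero    = cong f (h zero)
updateAt-cong-≗ zero    h (suc j) = h (suc j)
updateAt-cong-≗ (suc i) h zero    = h zero
updateAt-cong-≗ (suc i) h (suc j) = updateAt-cong-≗ i (h ∘ suc) j

subTm-updateAt : ∀ (τ : Env m n) (σ : Env l m) i t →
  subTm τ ∘ updateAt σ i (const t) ≗ updateAt (subTm τ ∘ σ) i (const (subTm τ t))
subTm-updateAt τ σ i t = map-updateAt {f = subTm τ} {g = const t} (λ _ → refl) σ i

-- `≐E` replaces variable 0 only, whereas the variable of `Pr` may sit anywhere in the matrix. So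
-- `ψ` puts a fresh `v0` at position `i` and shifts the other entries past it.
≐E-at : ∀ (φ : Formula m) (σ : Env m n) i {t u} → T ∣ Γ ⊢ t ≐ u →
        T ∣ Γ ⊢ sub (updateAt σ i (const t)) φ → T ∣ Γ ⊢ sub (updateAt σ i (const u)) φ
≐E-at {n = n} φ σ i {t} {u} e d =
  cast (ψ-[] u) (≐E ψ e (cast (sym (ψ-[] t)) d))
  where
  ψ : Formula (suc n)
  ψ = sub (updateAt (_↑ ∘ σ) i (const v0)) φ
  ψ-[] : ∀ t → ψ [ t ] ≡ sub (updateAt σ i (const t)) φ
  ψ-[] t = trans ([]-▸ ψ t) (sub-sub-≗ (λ j → trans
    (subTm-updateAt (t ▸ var) (_↑ ∘ σ) i v0 j)
    (updateAt-cong-≗ i (λ j → subTm-▸-↑ t (σ j)) j)) φ)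

-- Arithmetic in PA

PA-induction : ∀ (φ : Formula (suc m)) (σ : Env m n) t → PA ∣ Γ ⊢ sub (𝟎 ▸ σ) φ →
  PA ∣ sub (v0 ▸ (_↑ ∘ σ)) φ ∷ map weaken Γ ⊢ sub (s v0 ▸ (_↑ ∘ σ)) φ →
  PA ∣ Γ ⊢ sub (t ▸ σ) φ
PA-induction {Γ = Γ} φ σ t base step = ∀E▸ φ σ t (⊃E (∀*E _ σ (axiom (induction φ))) (⋀I
  (cast (sym (trans (cong (sub σ) ([]-▸ φ 𝟎))
    (sub-sub-≗ (λ { zero → refl ; (suc i) → refl }) φ))) base)
  (∀I (⊃I (subst₂ (λ ψ χ → PA ∣ ψ ∷ map weaken Γ ⊢ χ)
    (sub-cong (λ { zero → refl ; (suc i) → refl }) φ)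
    (sym (sub-sub-≗ (λ { zero → refl ; (suc i) → refl }) φ)) step)))))

⊕-𝟎 : ∀ (t : Term n) → PA ∣ Γ ⊢ t ⊕ 𝟎 ≐ t
⊕-𝟎 t = ∀*E (v0 ⊕ 𝟎 ≐ v0) (t ▸ ε) (axiom ⊕-0)

⊕-S : ∀ (t u : Term n) → PA ∣ Γ ⊢ t ⊕ s u ≐ s (t ⊕ u)
⊕-S t u = ∀*E (v1 ⊕ s v0 ≐ s (v1 ⊕ v0)) (u ▸ t ▸ ε) (axiom ⊕-s)

⊗-𝟎 : ∀ (t : Term n) → PA ∣ Γ ⊢ t ⊗ 𝟎 ≐ 𝟎
⊗-𝟎 t = ∀*E (v0 ⊗ 𝟎 ≐ 𝟎) (t ▸ ε) (axiom ⊗-0)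

⊗-S : ∀ (t u : Term n) → PA ∣ Γ ⊢ t ⊗ s u ≐ t ⊗ u ⊕ t
⊗-S t u = ∀*E (v1 ⊗ s v0 ≐ v1 ⊗ v0 ⊕ v1) (u ▸ t ▸ ε) (axiom ⊗-s)

≼⇔∃ : ∀ (t u : Term n) → PA ∣ Γ ⊢ sub (u ▸ t ▸ ε)
  ((v1 ≼ v0 ⊃ ∃′ (v0 ⊕ v2 ≐ v1)) ⋀ (∃′ (v0 ⊕ v2 ≐ v1) ⊃ v1 ≼ v0))
≼⇔∃ t u = ∀*E
  ((v1 ≼ v0 ⊃ ∃′ (v0 ⊕ v2 ≐ v1)) ⋀ (∃′ (v0 ⊕ v2 ≐ v1) ⊃ v1 ≼ v0))
  (u ▸ t ▸ ε) (axiom ≼-def)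

≼I : ∀ {t u : Term n} r → PA ∣ Γ ⊢ r ⊕ t ≐ u → PA ∣ Γ ⊢ t ≼ u
≼I {t = t} {u} r d = ⊃E (⋀E₂ (≼⇔∃ t u)) (∃I▸ (v0 ⊕ v2 ≐ v1) (u ▸ t ▸ ε) r d)

s-⊕ : ∀ (t u : Term n) → PA ∣ Γ ⊢ s t ⊕ u ≐ s (t ⊕ u)
s-⊕ t u = PA-induction (s v1 ⊕ v0 ≐ s (v1 ⊕ v0)) (t ▸ ε) u
  (≐-trans (⊕-𝟎 _) (s-cong (≐-sym (⊕-𝟎 _))))
  (≐-trans (⊕-S _ _) (s-cong (≐-trans hyp₀ (≐-sym (⊕-S _ _)))))

⊕-assoc : ∀ (t u v : Term n) → PA ∣ Γ ⊢ (t ⊕ u) ⊕ v ≐ t ⊕ (u ⊕ v)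
⊕-assoc t u v = PA-induction ((v1 ⊕ v2) ⊕ v0 ≐ v1 ⊕ (v2 ⊕ v0)) (t ▸ u ▸ ε) v
  (≐-trans (⊕-𝟎 _) (⊕-cong (≐I _) (≐-sym (⊕-𝟎 _))))
  (≐-trans (⊕-S _ _) (≐-trans (s-cong hyp₀)
    (≐-trans (≐-sym (⊕-S _ _)) (⊕-cong (≐I _) (≐-sym (⊕-S _ _))))))

⊕-swapʳ : ∀ (t u v : Term n) → PA ∣ Γ ⊢ (t ⊕ u) ⊕ v ≐ (t ⊕ v) ⊕ u
⊕-swapʳ t u v = PA-induction ((v1 ⊕ v0) ⊕ v2 ≐ (v1 ⊕ v2) ⊕ v0) (t ▸ v ▸ ε) u
  (≐-trans (⊕-cong (⊕-𝟎 _) (≐I _)) (≐-sym (⊕-𝟎 _)))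
  (≐-trans (⊕-cong (⊕-S _ _) (≐I _)) (≐-trans (s-⊕ _ _)
    (≐-trans (s-cong hyp₀) (≐-sym (⊕-S _ _)))))

≼-trans : ∀ {t u v : Term n} → PA ∣ Γ ⊢ t ≼ u → PA ∣ Γ ⊢ u ≼ v → PA ∣ Γ ⊢ t ≼ v
≼-trans {n} {Γ} {t} {u} {v} d e =
  ⊃E (⊃E implication (⊃E (⋀E₁ (≼⇔∃ t u)) d))
     (⊃E (⋀E₁ (≼⇔∃ u v)) e)
  where
  σ : Env 3 n
  σ = t ▸ u ▸ v ▸ ε
  implication : PA ∣ Γ ⊢ sub σ (∃′ (v0 ⊕ v1 ≐ v2) ⊃ ∃′ (v0 ⊕ v2 ≐ v3) ⊃ v0 ≼ v2)
  implication = ⊃I (∃E▸ (v0 ⊕ v1 ≐ v2) (∃′ (v0 ⊕ v2 ≐ v3) ⊃ v0 ≼ v2) σ hyp₀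
    -- The two differences add up: `v1` leads from t to u, and `v0` from u to v.
    (⊃I (∃E▸ (v0 ⊕ v3 ≐ v4) (v1 ≼ v3) (v0 ▸ (_↑ ∘ σ)) hyp₀ (≼I (v0 ⊕ v1)
      (≐-trans (⊕-assoc _ _ _) (≐-trans (⊕-cong (≐I _)
        (cast (weaken-sub (v0 ▸ (_↑ ∘ σ)) (v0 ⊕ v1 ≐ v2)) (hyp (there (there (here refl)))))) hyp₀))))))

≼-refl : ∀ {t : Term n} → PA ∣ Γ ⊢ t ≼ t
≼-refl {t = t} = ≼I 𝟎 (PA-induction (𝟎 ⊕ v0 ≐ v0) ε t (⊕-𝟎 _)
  (≐-trans (⊕-S _ _) (s-cong hyp₀)))

≼-⟨⟩₁ : ∀ (t u : Term n) → PA ∣ Γ ⊢ t ≼ ⟨ t , u ⟩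
≼-⟨⟩₁ t u = ≼I ((t ⊕ u) ⊗ (t ⊕ u)) (≐I _)

-- Components are bounded by their pair, so subcodes of a code below x stay below the cut-off in
-- `least`.
≼-⟨⟩₂ : ∀ (t u : Term n) → PA ∣ Γ ⊢ u ≼ ⟨ t , u ⟩
≼-⟨⟩₂ {n} t u = PA-induction (v0 ≼ ⟨ v1 , v0 ⟩) (t ▸ ε) u
  -- With w = t + u, the pair of t and u + 1 is (w + 1)w + (w + 1) + t; taking away u + 1 leaves (w
  -- + 1)w + t + t.
  (≼I _ (⊕-𝟎 _)) (≼I ((sq ⊕ t ↑) ⊕ t ↑) (≐-trans left (≐-sym right)))
  where
  sum sq : Term (suc n)
  sum = t ↑ ⊕ v0
  sq = s sum ⊗ sum
  left : PA ∣ Γ ⊢ ((sq ⊕ t ↑) ⊕ t ↑) ⊕ s v0 ≐ s ((sq ⊕ sum) ⊕ t ↑)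
  left = ≐-trans (⊕-S _ _) (s-cong (≐-trans (⊕-swapʳ _ _ _) (⊕-cong (⊕-assoc _ _ _) (≐I _))))
  right : PA ∣ Γ ⊢ ⟨ t ↑ , s v0 ⟩ ≐ s ((sq ⊕ sum) ⊕ t ↑)
  right = ≐-trans
    (⊕-cong (≐-trans (⊗-cong (⊕-S _ _) (⊕-S _ _)) (≐-trans (⊗-S _ _) (⊕-S _ _))) (≐I _))
    (s-⊕ _ _)

numeral-⊕ : ∀ a b → PA ∣ Γ ⊢ numeral {n} a ⊕ numeral b ≐ numeral (a + b)
numeral-⊕ a zero    rewrite +-identityʳ a = ⊕-𝟎 _
numeral-⊕ a (suc b) rewrite +-suc a b = ≐-trans (⊕-S _ _) (s-cong (numeral-⊕ a b))

numeral-⊗ : ∀ a b → PA ∣ Γ ⊢ numeral {n} a ⊗ numeral b ≐ numeral (a * b)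
numeral-⊗ a zero    rewrite *-zeroʳ a = ⊗-𝟎 _
numeral-⊗ a (suc b) rewrite *-suc a b | +-comm a (a * b) =
  ≐-trans (⊗-S _ _) (≐-trans (⊕-cong (numeral-⊗ a b) (≐I _)) (numeral-⊕ (a * b) a))

numeral-pair : ∀ {t u : Term n} {a b} → PA ∣ Γ ⊢ t ≐ numeral a → PA ∣ Γ ⊢ u ≐ numeral b →
               PA ∣ Γ ⊢ ⟨ t , u ⟩ ≐ numeral (pair a b)
numeral-pair {a = a} {b} d e = ≐-trans
  (⊕-cong (≐-trans (⊗-cong sum sum) (numeral-⊗ (a + b) (a + b))) d)
  (numeral-⊕ ((a + b) * (a + b)) a)
  where sum = ≐-trans (⊕-cong d e) (numeral-⊕ a b)

-- Codes of terms and formulas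

-- A sufficient condition for provability of sub σ φ that computes through ⋀, ⋁ and ∃′.
Forced : List (Formula n) → Env m n → Formula m → Set
Forced Γ σ (φ ⋀ ψ) = Forced Γ σ φ × Forced Γ σ ψ
Forced Γ σ (φ ⋁ ψ) = Forced Γ σ φ ⊎ Forced Γ σ ψ
Forced Γ σ (∃′ φ)  = (PA ∣ Γ ⊢ sub σ (∃′ φ)) ⊎ (Σ[ t ∈ _ ] Forced Γ (t ▸ σ) φ)
Forced Γ σ φ       = PA ∣ Γ ⊢ sub σ φ

Forced⇒⊢ : ∀ (φ : Formula m) {σ : Env m n} → Forced Γ σ φ → PA ∣ Γ ⊢ sub σ φ
Forced⇒⊢ (φ ⋀ ψ) (p , q)        = ⋀I (Forced⇒⊢ φ p) (Forced⇒⊢ ψ q)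
Forced⇒⊢ (φ ⋁ ψ) (inj₁ p)       = ⋁I₁ (Forced⇒⊢ φ p)
Forced⇒⊢ (φ ⋁ ψ) (inj₂ q)       = ⋁I₂ (Forced⇒⊢ ψ q)
Forced⇒⊢ (∃′ φ)  (inj₁ d)       = d
Forced⇒⊢ (∃′ φ)  (inj₂ (t , p)) = ∃I▸ φ _ t (Forced⇒⊢ φ p)
Forced⇒⊢ (t ≐ u) d = d
Forced⇒⊢ (t ≼ u) d = d
Forced⇒⊢ (∼ φ)   d = d
Forced⇒⊢ (φ ⊃ ψ) d = d
Forced⇒⊢ (∀′ φ)  d = d

-- The antecedent of `least` as a rule of inference about an arbitrary set with code `v1` and
-- parameter `v0`; `x` is shifted past both.
Closed : Formula 4 → Term n → List (Formula (2 + n)) → Set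
Closed step x Γ = ∀ y → PA ∣ Γ ⊢ y ≼ x ↑ ↑ → Forced Γ (y ▸ lift (lift (const x))) step →
  PA ∣ Γ ⊢ y ∈[ v1 , v0 ]

-- `f` is polymorphic in the context, so the assumed closure condition is used only through `Closed`
-- and never has to be spelled out.
leastI : ∀ (step : Formula 4) (x : Term n) →
         (∀ {Γ} → Closed step x Γ → PA ∣ Γ ⊢ x ↑ ↑ ∈[ v1 , v0 ]) → PA ∣ Γ ⊢ least step ⟪ x ⟫
leastI step x f = ∀I (∀I (⊃I (f λ y y≼x p → ⊃E
  (∀E▸ (v0 ≼ v3 ⋀ step ⊃ v0 ∈[ v2 , v1 ]) (lift (lift (const x))) y hyp₀)
  (⋀I y≼x (Forced⇒⊢ step p)))))

-- Unification recovers the generation rules from the unfolded formulas.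
TmCode-step : Σ[ step ∈ Formula 4 ] TmCode ≡ least step
TmCode-step = _ , refl

Fml-step : Σ[ step ∈ Formula 4 ] Fml ≡ least step
Fml-step = _ , refl

-- IsTmCode c says that ⟨ a , c ⟩ has the form of a term code for every a.
data IsTmCode {n} : Term n → Set where
  isZero : IsTmCode ⟨ 𝟎 , 𝟎 ⟩
  isVar  : ∀ t → IsTmCode ⟨ numeral 1 , t ⟩
  isSum  : ∀ {a b c d} → IsTmCode c → IsTmCode d →
           IsTmCode ⟨ numeral 2 , ⟨ ⟨ a , c ⟩ , ⟨ b , d ⟩ ⟩ ⟩
  isProd : ∀ {a b c d} → IsTmCode c → IsTmCode d →
           IsTmCode ⟨ numeral 3 , ⟨ ⟨ a , c ⟩ , ⟨ b , d ⟩ ⟩ ⟩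

IsTmCode-↑ : ∀ {c : Term n} → IsTmCode c → IsTmCode (c ↑)
IsTmCode-↑ isZero       = isZero
IsTmCode-↑ (isVar t)    = isVar (t ↑)
IsTmCode-↑ (isSum p q)  = isSum (IsTmCode-↑ p) (IsTmCode-↑ q)
IsTmCode-↑ (isProd p q) = isProd (IsTmCode-↑ p) (IsTmCode-↑ q)

-- A dotted variable becomes `⟨ x , ⟨ 𝟎 , 𝟎 ⟩ ⟩`, so the open term has the shape of a code whatever
-- the value of x, and recursion on the syntax outside PA suffices.
dotTm-isTmCode : ∀ m (t : Term (m + k)) → IsTmCode (proj₂ (dotTm m t))
dotTm-isTmCode m (var i) with splitAt m i
... | inj₁ j = isVar _
... | inj₂ x = isZero
dotTm-isTmCode m 𝟎       = isZero
dotTm-isTmCode m (s t)   = dotTm-isTmCode m t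
dotTm-isTmCode m (t ⊕ u) = isSum (dotTm-isTmCode m t) (dotTm-isTmCode m u)
dotTm-isTmCode m (t ⊗ u) = isProd (dotTm-isTmCode m t) (dotTm-isTmCode m u)

⟨,⟩≼₁ : ∀ {t u v : Term n} → PA ∣ Γ ⊢ ⟨ t , u ⟩ ≼ v → PA ∣ Γ ⊢ t ≼ v
⟨,⟩≼₁ = ≼-trans (≼-⟨⟩₁ _ _)

⟨,⟩≼₂ : ∀ {t u v : Term n} → PA ∣ Γ ⊢ ⟨ t , u ⟩ ≼ v → PA ∣ Γ ⊢ u ≼ v
⟨,⟩≼₂ = ≼-trans (≼-⟨⟩₂ _ _)

-- Recursion on the shape of the code: the parts enter the set first, bounded by `x` through the
-- whole code, and the rule for the outermost symbol then applies.
TmCode-closed : ∀ {x : Term n} → Closed (proj₁ TmCode-step) x Γ → ∀ {a c} → IsTmCode c →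
                PA ∣ Γ ⊢ ⟨ a , c ⟩ ≼ x ↑ ↑ → PA ∣ Γ ⊢ ⟨ a , c ⟩ ∈[ v1 , v0 ]
TmCode-closed {n} {Γ} {x} closed = member
  where
  member : ∀ {a c} → IsTmCode c → PA ∣ Γ ⊢ ⟨ a , c ⟩ ≼ x ↑ ↑ → PA ∣ Γ ⊢ ⟨ a , c ⟩ ∈[ v1 , v0 ]
  -- The injections select the disjunct of the generation rule; each `≐I` lets unification find the
  -- witnesses written `_`.
  member isZero h = closed _ h (inj₂ (_ , inj₂ (_ , ≐I _ , inj₁ (≐I _))))
  member (isVar t) h = closed _ h (inj₂ (_ , inj₂ (_ , ≐I _ , inj₂ (inj₁ (inj₂ (t , ≐I _))))))
  -- Membership is itself an existential formula, but known by a derivation and not by a witness;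
  -- hence `inj₁` in front of `member`.
  member (isSum p q) h = closed _ h (inj₂ (_ , inj₂ (_ , ≐I _ , inj₂ (inj₂ (inj₂ (_ , inj₂ (_ ,
    inj₁ (member p (⟨,⟩≼₁ (⟨,⟩≼₂ (⟨,⟩≼₂ h)))) ,
    inj₁ (member q (⟨,⟩≼₂ (⟨,⟩≼₂ (⟨,⟩≼₂ h)))) ,
    inj₁ (≐I _))))))))
  member (isProd p q) h = closed _ h (inj₂ (_ , inj₂ (_ , ≐I _ , inj₂ (inj₂ (inj₂ (_ , inj₂ (_ ,
    inj₁ (member p (⟨,⟩≼₁ (⟨,⟩≼₂ (⟨,⟩≼₂ h)))) ,
    inj₁ (member q (⟨,⟩≼₂ (⟨,⟩≼₂ (⟨,⟩≼₂ h)))) ,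
    inj₂ (≐I _))))))))

TmCode-intro : ∀ a {c : Term n} → IsTmCode c → PA ∣ Γ ⊢ TmCode ⟪ ⟨ a , c ⟩ ⟫
TmCode-intro a p = leastI (proj₁ TmCode-step) _ λ closed →
  TmCode-closed closed (IsTmCode-↑ (IsTmCode-↑ p)) ≼-refl

data IsFmlCode {n} : Term n → Set where
  isEq : ∀ {a b c d} → IsTmCode c → IsTmCode d →
         IsFmlCode ⟨ numeral 0 , ⟨ ⟨ a , c ⟩ , ⟨ b , d ⟩ ⟩ ⟩
  isLe : ∀ {a b c d} → IsTmCode c → IsTmCode d →
         IsFmlCode ⟨ numeral 1 , ⟨ ⟨ a , c ⟩ , ⟨ b , d ⟩ ⟩ ⟩
  isNot : ∀ {a} → IsFmlCode a → IsFmlCode ⟨ numeral 2 , a ⟩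
  isAnd : ∀ {a b} → IsFmlCode a → IsFmlCode b → IsFmlCode ⟨ numeral 3 , ⟨ a , b ⟩ ⟩
  isOr  : ∀ {a b} → IsFmlCode a → IsFmlCode b → IsFmlCode ⟨ numeral 4 , ⟨ a , b ⟩ ⟩
  isImp : ∀ {a b} → IsFmlCode a → IsFmlCode b → IsFmlCode ⟨ numeral 5 , ⟨ a , b ⟩ ⟩
  isAll : ∀ {a} → IsFmlCode a → IsFmlCode ⟨ numeral 6 , a ⟩
  isEx  : ∀ {a} → IsFmlCode a → IsFmlCode ⟨ numeral 7 , a ⟩

IsFmlCode-↑ : ∀ {a : Term n} → IsFmlCode a → IsFmlCode (a ↑)
IsFmlCode-↑ (isEq p q)  = isEq (IsTmCode-↑ p) (IsTmCode-↑ q)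
IsFmlCode-↑ (isLe p q)  = isLe (IsTmCode-↑ p) (IsTmCode-↑ q)
IsFmlCode-↑ (isNot p)   = isNot (IsFmlCode-↑ p)
IsFmlCode-↑ (isAnd p q) = isAnd (IsFmlCode-↑ p) (IsFmlCode-↑ q)
IsFmlCode-↑ (isOr p q)  = isOr (IsFmlCode-↑ p) (IsFmlCode-↑ q)
IsFmlCode-↑ (isImp p q) = isImp (IsFmlCode-↑ p) (IsFmlCode-↑ q)
IsFmlCode-↑ (isAll p)   = isAll (IsFmlCode-↑ p)
IsFmlCode-↑ (isEx p)    = isEx (IsFmlCode-↑ p)

dot-isFmlCode : ∀ m (φ : Formula (m + k)) → IsFmlCode (dot m φ)
dot-isFmlCode m (t ≐ u) = isEq (dotTm-isTmCode m t) (dotTm-isTmCode m u)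
dot-isFmlCode m (t ≼ u) = isLe (dotTm-isTmCode m t) (dotTm-isTmCode m u)
dot-isFmlCode m (∼ φ)   = isNot (dot-isFmlCode m φ)
dot-isFmlCode m (φ ⋀ ψ) = isAnd (dot-isFmlCode m φ) (dot-isFmlCode m ψ)
dot-isFmlCode m (φ ⋁ ψ) = isOr (dot-isFmlCode m φ) (dot-isFmlCode m ψ)
dot-isFmlCode m (φ ⊃ ψ) = isImp (dot-isFmlCode m φ) (dot-isFmlCode m ψ)
dot-isFmlCode m (∀′ φ)  = isAll (dot-isFmlCode (suc m) φ)
dot-isFmlCode m (∃′ φ)  = isEx (dot-isFmlCode (suc m) φ)

Fml-closed : ∀ {x : Term n} → Closed (proj₁ Fml-step) x Γ → ∀ {a} → IsFmlCode a →
             PA ∣ Γ ⊢ a ≼ x ↑ ↑ → PA ∣ Γ ⊢ a ∈[ v1 , v0 ]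
Fml-closed {n} {Γ} {x} closed = member
  where
  Member : Term (2 + n) → Set
  Member a = PA ∣ Γ ⊢ a ∈[ v1 , v0 ]

  member : ∀ {a} → IsFmlCode a → PA ∣ Γ ⊢ a ≼ x ↑ ↑ → Member a
  unary  : ∀ {a b} → IsFmlCode a → PA ∣ Γ ⊢ ⟨ b , a ⟩ ≼ x ↑ ↑ → Member a
  binary : ∀ {a b c} → IsFmlCode a → IsFmlCode b →
           PA ∣ Γ ⊢ ⟨ c , ⟨ a , b ⟩ ⟩ ≼ x ↑ ↑ → Member a × Member b

  unary p h = member p (⟨,⟩≼₂ h)
  binary p q h = member p (⟨,⟩≼₁ (⟨,⟩≼₂ h)) , member q (⟨,⟩≼₂ (⟨,⟩≼₂ h))

  member (isEq p q) h =
    closed _ h (inj₁ (inj₂ (_ , inj₂ (_ , TmCode-intro _ p , TmCode-intro _ q , inj₁ (≐I _)))))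
  member (isLe p q) h =
    closed _ h (inj₁ (inj₂ (_ , inj₂ (_ , TmCode-intro _ p , TmCode-intro _ q , inj₂ (≐I _)))))
  member (isNot p) h = closed _ h (inj₂ (inj₁ (inj₂ (_ , inj₁ (unary p h) , inj₁ (≐I _)))))
  member (isAll p) h = closed _ h (inj₂ (inj₁ (inj₂ (_ , inj₁ (unary p h) , inj₂ (inj₁ (≐I _))))))
  member (isEx p) h = closed _ h (inj₂ (inj₁ (inj₂ (_ , inj₁ (unary p h) , inj₂ (inj₂ (≐I _))))))
  member (isAnd p q) h = let (a∈ , b∈) = binary p q h in
    closed _ h (inj₂ (inj₂ (inj₂ (_ , inj₂ (_ , inj₁ a∈ , inj₁ b∈ , inj₁ (≐I _))))))
  member (isOr p q) h = let (a∈ , b∈) = binary p q h in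
    closed _ h (inj₂ (inj₂ (inj₂ (_ , inj₂ (_ , inj₁ a∈ , inj₁ b∈ , inj₂ (inj₁ (≐I _)))))))
  member (isImp p q) h = let (a∈ , b∈) = binary p q h in
    closed _ h (inj₂ (inj₂ (inj₂ (_ , inj₂ (_ , inj₁ a∈ , inj₁ b∈ , inj₂ (inj₂ (≐I _)))))))

-- The code may be an open term: at `⌜ χ ˙⌝` this discharges the conjunct `Fml` of `Conᴴ` for all
-- values of the variables at once.
Fml-intro : ∀ {a : Term n} → IsFmlCode a → PA ∣ Γ ⊢ Fml ⟪ a ⟫
Fml-intro p = leastI (proj₁ Fml-step) _ λ closed →
  Fml-closed closed (IsFmlCode-↑ (IsFmlCode-↑ p)) ≼-refl

-- Prenex Σ₁ formulas

-- Stripping the prefix frees its variables; `level` counts all variables then in scope, and `free`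
-- below locates the original ones among them.
level : {φ : Formula n} → Σ₁ φ → ℕ
level {n} (Δ₀⇒Σ₁ _) = n
level     (ex p)    = level p

matrix : {φ : Formula n} (p : Σ₁ φ) → Formula (level p)
matrix {φ = φ} (Δ₀⇒Σ₁ _) = φ
matrix         (ex p)    = matrix p

matrix-Δ₀ : {φ : Formula n} (p : Σ₁ φ) → Δ₀ (matrix p)
matrix-Δ₀ (Δ₀⇒Σ₁ d) = d
matrix-Δ₀ (ex p)    = matrix-Δ₀ p

free : {φ : Formula n} (p : Σ₁ φ) → Fin n → Fin (level p)
free (Δ₀⇒Σ₁ _) = id
free (ex p)    = free p ∘ suc

-- The entries of `σ` outside the image of `free p` are the witnesses for the prefix.
Σ₁-intro : {φ : Formula m} (p : Σ₁ φ) (σ : Env (level p) n) →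
           T ∣ Γ ⊢ sub σ (matrix p) → T ∣ Γ ⊢ sub (σ ∘ free p) φ
Σ₁-intro (Δ₀⇒Σ₁ _)        σ d = d
Σ₁-intro (ex {φ = φ} p) σ d = ∃I▸ φ (σ ∘ free p ∘ suc) (σ (free p zero))
  (cast (sub-cong (λ { zero → refl ; (suc i) → refl }) φ) (Σ₁-intro p σ d))

-- Numerals and sentences are unaffected by shifting, so the condition on `σ` and the context both
-- survive the passage under each existential.
Σ₁-refute : ∀ {Γ : List Sentence} {φ : Formula m} (p : Σ₁ φ) i a →
  (∀ {n} (σ : Env (level p) n) → σ (free p i) ≡ numeral a →
    T ∣ map embed Γ ⊢ ∼ sub σ (matrix p)) →
  ∀ {n} (σ : Env m n) → σ i ≡ numeral a → T ∣ map embed Γ ⊢ ∼ sub σ φ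
Σ₁-refute (Δ₀⇒Σ₁ _) i a h = h
Σ₁-refute {T = T} {Γ} (ex {φ = φ} p) i a h σ e = ∼∃I (sub (lift σ) φ) (∀I
  (subst (T ∣_⊢ ∼ sub (lift σ) φ) (sym (map-weaken-embed Γ))
    (Σ₁-refute {Γ = Γ} p (suc i) a h (lift σ) (trans (cong _↑ e) (↑-numeral a)))))

sub-Δ₀ : ∀ (σ : Env m n) {φ} → Δ₀ φ → Δ₀ (sub σ φ)
sub-Δ₀ σ (eq t u)  = eq _ _
sub-Δ₀ σ (le t u)  = le _ _
sub-Δ₀ σ (neg d)   = neg (sub-Δ₀ σ d)
sub-Δ₀ σ (and d e) = and (sub-Δ₀ σ d) (sub-Δ₀ σ e)
sub-Δ₀ σ (or d e)  = or (sub-Δ₀ σ d) (sub-Δ₀ σ e)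
sub-Δ₀ σ (imp d e) = imp (sub-Δ₀ σ d) (sub-Δ₀ σ e)
sub-Δ₀ σ (all t {φ} d) =
  -- The new bound has to be exhibited as a shifted term, free of the quantified variable.
  subst (λ u → Δ₀ (∀′ (v0 ≼ u ⊃ sub (lift σ) φ))) (sym (subTm-lift-↑ σ t))
    (all (subTm σ t) (sub-Δ₀ (lift σ) d))
sub-Δ₀ σ (ex t {φ} d) =
  subst (λ u → Δ₀ (∃′ (v0 ≼ u ⋀ sub (lift σ) φ))) (sym (subTm-lift-↑ σ t))
    (ex (subTm σ t) (sub-Δ₀ (lift σ) d))

-- Reflection

-- Consistency, `CB` at `χ` and `Δ₀Cᵁ` at `∼ χ` become formal assumptions, so that reflection is a
-- derivation in PA.
Reflection-hypotheses : Formula 1 → Formula n → List Sentence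
Reflection-hypotheses Pr χ =
  Conᴴ Pr ∷ (Pr ⟪ ⌜ ∀* χ ⌝ ⟫ ⊃ ∀* (Pr ⟪ ⌜ χ ˙⌝ ⟫)) ∷ ∀* (∼ χ ⊃ Pr ⟪ ⌜ ∼ χ ˙⌝ ⟫) ∷ []

reflection : ∀ Pr (χ : Formula n) →
  PA ∣ Pr ⟪ ⌜ ∀* χ ⌝ ⟫ ∷ Reflection-hypotheses Pr χ ⊢ ∀* χ
-- The conclusion of `CB` is cut in while it is still a sentence, since `∀*I` opens the variables
-- over embedded sentences only.
reflection {n} Pr χ = cut (⊃E (hyp (there (there (here refl)))) hyp₀)
  (∀*I χ (∼∼E (∼I dotted-∼χ (⊃E consistency (⋀I (Fml-intro (dot-isFmlCode 0 χ)) dotted-χ)))))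
  where
  Δ : List (Formula n)
  Δ = (∼ χ) ∷ map embed (∀* (Pr ⟪ ⌜ χ ˙⌝ ⟫) ∷ Pr ⟪ ⌜ ∀* χ ⌝ ⟫ ∷ Reflection-hypotheses Pr χ)

  close : ∀ (φ : Formula n) → PA ∣ Δ ⊢ embed (∀* φ) → PA ∣ Δ ⊢ φ
  close φ d = cast (sub-var φ) (∀*E φ var d)

  dotted-χ : PA ∣ Δ ⊢ Pr ⟪ ⌜ χ ˙⌝ ⟫
  dotted-χ = close _ hyp₁

  consistency : PA ∣ Δ ⊢ Fml ⟪ ⌜ χ ˙⌝ ⟫ ⋀ Pr ⟪ ⌜ χ ˙⌝ ⟫ ⊃ ∼ Pr ⟪ ⌜ ∼ χ ˙⌝ ⟫
  -- `∼̇ ⌜ χ ˙⌝` and `⌜ ∼ χ ˙⌝` are the same term by computation; only two successive substitutions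
  -- into `Pr` have to be merged.
  consistency = cast
    (cong (λ φ → Fml ⟪ ⌜ χ ˙⌝ ⟫ ⋀ Pr ⟪ ⌜ χ ˙⌝ ⟫ ⊃ ∼ φ) (sub-sub (const ⌜ χ ˙⌝) (const (∼̇ v0)) Pr))
    (∀*E (Fml ⋀ Pr ⊃ ∼ Pr ⟪ ∼̇ v0 ⟫) (const ⌜ χ ˙⌝) (hyp (there (there (there (here refl))))))

  dotted-∼χ : PA ∣ Δ ⊢ Pr ⟪ ⌜ ∼ χ ˙⌝ ⟫
  dotted-∼χ = ⊃E (close (∼ χ ⊃ Pr ⟪ ⌜ ∼ χ ˙⌝ ⟫)
    (hyp (there (there (there (there (there (here refl)))))))) hyp₀

-- Diagonalization

gnTm-numeral : ∀ a → gnTm (numeral {n} a) ≡ (a , 0)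
gnTm-numeral zero    = refl
gnTm-numeral (suc a) = cong (λ (b , c) → suc b , c) (gnTm-numeral a)

∀*-code : ℕ → Term n → Term n
∀*-code zero    t = t
∀*-code (suc m) t = ∀*-code m ⟨ numeral 6 , t ⟩

⌜∀*⌝ : ∀ (φ : Formula m) {t : Term n} → PA ∣ Γ ⊢ t ≐ ⌜ φ ⌝ → PA ∣ Γ ⊢ ∀*-code m t ≐ ⌜ ∀* φ ⌝
⌜∀*⌝ {zero}  φ d = d
⌜∀*⌝ {suc m} φ d = ⌜∀*⌝ (∀′ φ) (numeral-pair {a = 6} (≐I _) d)

subTm-∀*-code : ∀ l (σ : Env m n) t → subTm σ (∀*-code l t) ≡ ∀*-code l (subTm σ t)
subTm-∀*-code zero    σ t = refl
subTm-∀*-code (suc l) σ t = subTm-∀*-code l σ ⟨ numeral 6 , t ⟩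

-- Guarding φ by x = ⌜ φ ⌝, instead of substituting the numeral into φ, makes the code
-- of the diagonalization a polynomial in the code of φ.
diagonal : Fin m → Formula m → Formula m
diagonal x φ = var x ≐ ⌜ φ ⌝ ⊃ φ

-- Since pair 0 0 = 0, the code ⟨ t , ⟨ 𝟎 , 𝟎 ⟩ ⟩ of a numeral is shortened to ⟨ t , 𝟎 ⟩.
diagonal-code : Fin m → Term n → Term n
diagonal-code {m} x t = ∀*-code m ⟨ numeral 5 , ⟨ ⟨ numeral 0 ,
  ⟨ ⟨ 𝟎 , ⟨ numeral 1 , numeral (toℕ x) ⟩ ⟩ , ⟨ t , 𝟎 ⟩ ⟩ ⟩ , t ⟩ ⟩

-- Only provable equality is asked of `t`, so the variable `x` itself qualifies under the guard
-- `x ≐ ⌜ φ ⌝`. PA evaluates the polynomial from the inside out.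
⌜diagonal⌝ : ∀ (x : Fin m) φ {t : Term n} → PA ∣ Γ ⊢ t ≐ ⌜ φ ⌝ →
             PA ∣ Γ ⊢ diagonal-code x t ≐ ⌜ ∀* (diagonal x φ) ⌝
⌜diagonal⌝ {m} {n} {Γ} x φ {t} d = ⌜∀*⌝ (diagonal x φ) (numeral-pair {a = 5} (≐I _)
  (numeral-pair (numeral-pair {a = 0} (≐I _)
    (numeral-pair {b = gnTerm {m} ⌜ φ ⌝} code-var code-numeral)) d))
  where
  code-var : PA ∣ Γ ⊢ ⟨ 𝟎 , ⟨ numeral 1 , numeral (toℕ x) ⟩ ⟩ ≐ numeral (gnTerm (var x))
  code-var = numeral-pair {a = 0} (≐I _) (numeral-pair {a = 1} (≐I _) (≐I _))
  code-numeral : PA ∣ Γ ⊢ ⟨ t , 𝟎 ⟩ ≐ numeral (gnTerm {m} ⌜ φ ⌝)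
  code-numeral = cast
    (cong (λ (a , b) → ⟨ t , 𝟎 ⟩ ≐ numeral (pair a b)) (sym (gnTm-numeral (gn φ))))
    (numeral-pair {b = 0} d (≐I _))

subTm-diagonal-code : ∀ (σ : Env m n) (x : Fin l) t →
                      subTm σ (diagonal-code x t) ≡ diagonal-code x (subTm σ t)
subTm-diagonal-code {l = l} σ x t = trans (subTm-∀*-code l σ _)
  (cong (λ u → ∀*-code l ⟨ numeral 5 , ⟨ ⟨ numeral 0 ,
    ⟨ ⟨ 𝟎 , ⟨ numeral 1 , u ⟩ ⟩ , ⟨ subTm σ t , 𝟎 ⟩ ⟩ ⟩ , subTm σ t ⟩ ⟩) (subTm-numeral σ (toℕ x)))

-- A Gödel sentence in prenex Π₁ form

module Gödel {Pr : Formula 1} (p : Σ₁ Pr) where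

  x : Fin (level p)
  x = free p zero

  code-x : Term (level p)
  code-x = diagonal-code x (var x)

  ζ : Env (level p) (level p)
  ζ = updateAt var x (const code-x)

  -- `θ` denies that the remaining variables witness `Pr` at the diagonalization of `x`. All
  -- variables stay free, so `γ` is a block of universal quantifiers before a Δ₀ formula. At x =
  -- `⌜ θ ⌝`, the diagonalization is `γ` itself.
  θ χ : Formula (level p)
  θ = ∼ sub ζ (matrix p)
  χ = diagonal x θ

  χ-Δ₀ : Δ₀ χ
  χ-Δ₀ = imp (eq _ _) (neg (sub-Δ₀ ζ (matrix-Δ₀ p)))

  γ : Sentence
  γ = ∀* χ

  ∼Pr⇒γ : PA ⊢ ∼ Pr ⟪ ⌜ γ ⌝ ⟫ ⊃ γ
  ∼Pr⇒γ = ⊃I (∀*I χ (⊃I (∼I Pr-γ (cast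
      (cong ∼_ (sub-sub-≗ (λ _ → subTm-numeral _ (gn γ)) Pr))
      (hyp (there (there (here refl))))))))
    where
    Γ₀ = sub ζ (matrix p) ∷ (var x ≐ ⌜ θ ⌝) ∷ map embed ((∼ Pr ⟪ ⌜ γ ⌝ ⟫) ∷ [])
    Pr-γ : PA ∣ Γ₀ ⊢ Pr ⟪ ⌜ γ ⌝ ⟫
    Pr-γ = cast (sub-cong (λ { zero → updateAt-updates x var }) Pr)
      (Σ₁-intro p (updateAt var x (const ⌜ γ ⌝))
        -- Under the guard, `code-x` equals `⌜ γ ⌝`; the other variables are then witnesses for
        -- `Pr ⟪ ⌜ γ ⌝ ⟫`.
        (≐E-at (matrix p) var x (⌜diagonal⌝ x θ hyp₁) hyp₀))

  γ⇒∼Pr : ∀ (Γ : List Sentence) → PA ∣ γ ∷ Γ ⊢ ∼ Pr ⟪ ⌜ γ ⌝ ⟫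
  γ⇒∼Pr Γ = subst (PA ∣_⊢ ∼ Pr ⟪ ⌜ γ ⌝ ⟫) (map-embed-id (γ ∷ Γ))
    (Σ₁-refute {Γ = γ ∷ Γ} p zero (gn γ) refute-matrix (const ⌜ γ ⌝) refl)
    where
    refute-matrix : ∀ {n} (σ : Env (level p) n) → σ x ≡ ⌜ γ ⌝ →
                    PA ∣ map embed (γ ∷ Γ) ⊢ ∼ sub σ (matrix p)
    -- `σ` already has `⌜ γ ⌝` at `x`, so it suffices to refute the matrix after overwriting that
    -- entry by the provably equal `diagonal-code` of `⌜ θ ⌝`.
    refute-matrix {n} σ σx≡γ = cast (sub-cong (updateAt-id-local x σ (sym σx≡γ)) (∼ matrix p))
      (≐E-at (∼ matrix p) σ x (⌜diagonal⌝ x θ τx≐θ)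
        (cast (sub-sub-≗ τζ (∼ matrix p))
          (⊃E (∀*E χ τ hyp₀) (cast (cong (τ x ≐_) (sym (subTm-numeral τ (gn θ)))) τx≐θ))))
      where
      -- `γ` is instantiated with `⌜ θ ⌝` for `x`, which makes the guard reflexivity, and with the
      -- candidate witnesses of `σ` elsewhere.
      τ : Env (level p) n
      τ = updateAt σ x (const ⌜ θ ⌝)
      τx≐θ : PA ∣ map embed (γ ∷ Γ) ⊢ τ x ≐ ⌜ θ ⌝
      τx≐θ = cast (cong (τ x ≐_) (updateAt-updates x σ)) (≐I (τ x))
      τζ : subTm τ ∘ ζ ≗ updateAt σ x (const (diagonal-code x (τ x)))
      τζ j = begin
        subTm τ (ζ j)
          ≡⟨ subTm-updateAt τ var x code-x j ⟩
        updateAt τ x (const (subTm τ code-x)) j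
          ≡⟨ updateAt-updateAt x σ j ⟩
        updateAt σ x (const (subTm τ code-x)) j
          ≡⟨ cong (λ t → updateAt σ x (const t) j) (subTm-diagonal-code τ x (var x)) ⟩
        updateAt σ x (const (diagonal-code x (τ x))) j ∎
        where open ≡-Reasoning

-- Unprovability of `Conᴴ`

theorem3p10 : (S T : Theory) →
    Consistent S → Consistent T →
    CETheory S → CETheory T →
    PA ⊑ S → PA ⊑ T → S ⊑ T →
    (Pr : Formula 1) → Σ₁ Pr →
    IsProvabilityPredicate S T Pr →
    CB S Pr → Δ₀Cᵁ S Pr →
    ¬ (T ⊢ Conᴴ Pr)
theorem3p10 S T _ T-consistent _ _ _ PA⊑T S⊑T Pr p provable cb δc con =
  T-consistent (Pr ⟪ ⌜ γ ⌝ ⟫) (S⊑T _ (Equivalence.to (provable γ) T⊢γ) , T⊢∼Pr)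
  where
  open Gödel p
  -- `⊑` transfers derivations without hypotheses, so the assumptions of `reflection` are first
  -- discharged into one implication.
  PA⊢ : PA ⊢ ∀* (∼ χ ⊃ Pr ⟪ ⌜ ∼ χ ˙⌝ ⟫) ⊃
             (Pr ⟪ ⌜ γ ⌝ ⟫ ⊃ ∀* (Pr ⟪ ⌜ χ ˙⌝ ⟫)) ⊃ Conᴴ Pr ⊃ ∼ Pr ⟪ ⌜ γ ⌝ ⟫
  PA⊢ = ⊃I (⊃I (⊃I (∼I hyp₀ (cut (reflection Pr χ) (γ⇒∼Pr _)))))
  T⊢∼Pr : T ⊢ ∼ Pr ⟪ ⌜ γ ⌝ ⟫
  T⊢∼Pr = ⊃E (⊃E (⊃E (PA⊑T _ PA⊢) (S⊑T _ (δc (∼ χ) (neg χ-Δ₀)))) (S⊑T _ (cb χ))) con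
  T⊢γ : T ⊢ γ
  T⊢γ = ⊃E (PA⊑T _ ∼Pr⇒γ) T⊢∼Pr
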